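{- Let $n \geq 1$ and $b \ge 0$ be integers and let $d = 2\lceil \log n\rceil + 3$. If there is a $b$-bit protocol for the orthogonal vectors problem in which Alice and Bob each hold $n$ vectors of dimension $d$, then there is a $b$-bit protocol for the set disjointness problem in which Alice and Bob each hold an $n$-dimensional bit vector.
   Context: All problems are in the standard two-party communication model: Alice and Bob each hold a private input and exchange bits according to a protocol in order to determine the answer; a $b$-bit protocol is one in which at most $b$ bits are exchanged in total (in the worst case). Protocols may be deterministic, or randomized with bounded error (correct on every input with probability at least $2/3$); the protocol obtained is of the same type as the given one. $\log$ is the base-2 logarithm. Set disjointness problem: Alice holds $x \in \{0,1\}^n$, Bob holds $y \in \{0,1\}^n$, and they must determine whether there is an index $k$ with $x[k] = y[k] = 1$ (in which case $x$ and $y$ are "not disjoint"). Orthogonal vectors problem (with $n$ vectors of dimension $d$): Alice holds a set of bit vectors $L = \{l_1,\dots,l_n\} \subseteq \{0,1\}^d$, Bob holds a set of bit vectors $R = \{r_1,\dots,r_n\}\subseteq \{0,1\}^d$, and they must determine whether there are $l_i \in L$ and $r_j \in R$ that are orthogonal, i.e., such that for every $1 \le k \le d$ we have $l_i[k] = 0$ or $r_j[k] = 0$. -}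

module Defs where

open import Level using (0ℓ)
open import Data.Bool using (Bool; true; false)
import Data.Bool.Properties as Bool
open import Data.Fin using (Fin; remQuot)
open import Data.Fin.Properties using (any?; all?)
open import Data.Fin.Subset using (∣_∣)
open import Data.Integer using (+_)
open import Data.Nat using (ℕ; suc; _*_; _≤_; NonZero)
open import Data.Nat.Properties using (m*n≢0)
open import Data.Product using (Σ-syntax; ∃-syntax; _×_; _,_; uncurry)
open import Data.Rational as ℚ using (ℚ)
open import Data.Sum using (_⊎_)
open import Data.Vec using (Vec; lookup; tabulate)
open import Data.Vec.Relation.Unary.Unique.Propositional using (Unique)
open import Relation.Binary using (REL; Decidable)
open import Relation.Binary.PropositionalEquality using (_≡_)
open import Relation.Nullary using (does)
open import Relation.Nullary.Decidable using (_⊎-dec_; _×-dec_)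

------------------------------------------------------------------------
-- Two-party problems

record Problem : Set₁ where
  field
    Alice : Set
    Bob   : Set
    Yes   : REL Alice Bob 0ℓ
    yes?  : Decidable Yes

  answer : Alice → Bob → Bool
  answer x y = does (yes? x y)

------------------------------------------------------------------------
-- Protocols

-- Since all earlier bits are recorded by the position in the tree, the bit
-- sent at a node is a function of the speaker's private input only.  A leaf
-- carries the output, which is thus known to both players.

data Protocol (X Y : Set) : Set where
  output    : Bool → Protocol X Y
  aliceSays : (X → Bool) → (Bool → Protocol X Y) → Protocol X Y
  bobSays   : (Y → Bool) → (Bool → Protocol X Y) → Protocol X Y

module _ {X Y : Set} where

  result : Protocol X Y → X → Y → Bool
  result (output a)         x y = a
  result (aliceSays f next) x y = result (next (f x)) x y
  result (bobSays g next)   x y = result (next (g y)) x y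

  bitsExchanged : Protocol X Y → X → Y → ℕ
  bitsExchanged (output a)         x y = 0
  bitsExchanged (aliceSays f next) x y = suc (bitsExchanged (next (f x)) x y)
  bitsExchanged (bobSays g next)   x y = suc (bitsExchanged (next (g y)) x y)

------------------------------------------------------------------------
-- Randomness

-- Uniform probability on Fin m of the event with indicator function E.

Pr : ∀ m .{{_ : NonZero m}} → (Fin m → Bool) → ℚ
Pr m E = + ∣ tabulate E ∣ ℚ./ m

-- The same for a pair of independent uniform elements of Fin m and Fin k;
-- remQuot is the bijection Fin (m * k) → Fin m × Fin k.

Pr₂ : ∀ m k .{{_ : NonZero m}} .{{_ : NonZero k}} → (Fin m → Fin k → Bool) → ℚ
Pr₂ m k E =
  Pr (m * k) {{m*n≢0 m k}} (λ i → uncurry E (remQuot {m} k i))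

data Kind : Set where
  deterministic publicCoin privateCoin : Kind

module _ (P : Problem) (b : ℕ) where

  open Problem P

  correct : Bool → Alice → Bob → Bool
  correct a x y = does (a Bool.≟ answer x y)

  DeterministicProtocol : Set
  DeterministicProtocol =
    Σ[ π ∈ Protocol Alice Bob ]
      (∀ x y → bitsExchanged π x y ≤ b)
    × (∀ x y → result π x y ≡ answer x y)

  -- The shared random string ω selects the protocol that is executed.
  PublicCoinProtocol : Set
  PublicCoinProtocol =
    ∃[ m ] Σ[ m≢0 ∈ NonZero m ] Σ[ π ∈ (Fin m → Protocol Alice Bob) ]
      (∀ ω x y → bitsExchanged (π ω) x y ≤ b)
    × (∀ x y → (+ 2 ℚ./ 3) ℚ.≤
         Pr m {{m≢0}} (λ ω → correct (result (π ω) x y) x y))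

  -- Each player's random string is an additional part of their private input.
  PrivateCoinProtocol : Set
  PrivateCoinProtocol =
    ∃[ m ] ∃[ k ] Σ[ m≢0 ∈ NonZero m ] Σ[ k≢0 ∈ NonZero k ]
    Σ[ π ∈ Protocol (Fin m × Alice) (Fin k × Bob) ]
      (∀ α β x y → bitsExchanged π (α , x) (β , y) ≤ b)
    × (∀ x y → (+ 2 ℚ./ 3) ℚ.≤
         Pr₂ m k {{m≢0}} {{k≢0}}
           (λ α β → correct (result π (α , x) (β , y)) x y))

HasProtocol : Kind → Problem → ℕ → Set
HasProtocol deterministic P b = DeterministicProtocol P b
HasProtocol publicCoin    P b = PublicCoinProtocol P b
HasProtocol privateCoin   P b = PrivateCoinProtocol P b

------------------------------------------------------------------------
-- The problems, with true for the bit 1 and false for the bit 0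

BitVector : ℕ → Set
BitVector = Vec Bool

setDisjointness : ℕ → Problem
setDisjointness n = record
  { Alice = BitVector n
  ; Bob   = BitVector n
  ; Yes   = λ x y → ∃[ k ] (lookup x k ≡ true × lookup y k ≡ true)
  ; yes?  = λ x y → any? λ k →
              (lookup x k Bool.≟ true) ×-dec (lookup y k Bool.≟ true)
  }

-- A set of exactly n vectors, presented by an enumeration without
-- repetitions.  Protocols may depend on the order of the enumeration; this
-- gives them no extra power, since a player can first sort their own vectors.

record VectorSet (n d : ℕ) : Set where
  field
    vectors   : Vec (BitVector d) n
    .distinct : Unique vectors

open VectorSet public

Orthogonal : ∀ {d} → BitVector d → BitVector d → Set
Orthogonal l r = ∀ k → lookup l k ≡ false ⊎ lookup r k ≡ false

orthogonal? : ∀ {d} → Decidable (Orthogonal {d})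
orthogonal? l r = all? λ k →
  (lookup l k Bool.≟ false) ⊎-dec (lookup r k Bool.≟ false)

orthogonalVectors : ℕ → ℕ → Problem
orthogonalVectors n d = record
  { Alice = VectorSet n d
  ; Bob   = VectorSet n d
  ; Yes   = λ L R →
      ∃[ i ] ∃[ j ] Orthogonal (lookup (vectors L) i) (lookup (vectors R) j)
  ; yes?  = λ L R → any? λ i → any? λ j →
              orthogonal? (lookup (vectors L) i) (lookup (vectors R) j)
  }

{-# OPTIONS --safe #-}

-- The players tag each index k with the ⌈log n⌉-bit code e(k) of k.  Alice's
-- k-th vector starts with e(k) followed by its complement, Bob's k-th vector
-- with the complement followed by e(k), so that these 2⌈log n⌉ coordinates of
-- Alice's i-th and Bob's j-th vector are orthogonal precisely when i = j.  The
-- tails (1, ¬x[i], 0) and (¬y[j], 1, 0) are orthogonal precisely when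
-- x[i] = y[j] = 1.  The codes make the vectors of each player distinct, and
-- each player computes their vectors without communication.

module Submission where

open import Defs
open import Data.Nat using (ℕ; _+_; _*_; _≥_)
open import Data.Nat.Logarithm using (⌈log₂_⌉)

open import Data.Bool using (Bool; true; false; not)
import Data.Bool.Properties as Bool
open import Data.Fin using (Fin; zero; suc; combine; inject≤; finToFun; funToFin; remQuot)
open import Data.Fin.Properties using (2↔Bool; inject≤-injective; funToFin-finToFin)
open import Data.Fin.Subset using (∣_∣)
import Data.Integer as ℤ
open import Data.Nat using (zero; suc; _≤_; _<_; _^_; ⌊_/2⌋; ⌈_/2⌉; NonZero; z≤n; s≤s)
open import Data.Nat.Induction using (<-wellFounded)
open import Data.Nat.Logarithm.Core using (⌈log2⌉)
open import Data.Nat.Properties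
  using (⌊n/2⌋≤⌈n/2⌉; ⌊n/2⌋+⌈n/2⌉≡n; +-monoˡ-≤; +-monoʳ-≤; +-identityʳ;
         *-suc; *-monoʳ-≤; m*n≢0; module ≤-Reasoning)
open import Data.Product using (_×_; _,_; proj₁; map₂)
import Data.Rational as ℚ
open import Data.Sum using (_⊎_; inj₁; inj₂)
open import Data.Vec using ([]; _∷_; _++_; map; lookup; tabulate)
open import Data.Vec.Properties
  using (tabulate-cong; lookup∘tabulate; ++-injectiveˡ; ++-injectiveʳ)
open import Data.Vec.Relation.Binary.Pointwise.Extensional as Extensional
  using (ext; extensional⇒inductive; inductive⇒extensional)
open import Data.Vec.Relation.Binary.Pointwise.Inductive
  using (Pointwise; []; _∷_; ++⁺; ++⁻; tabulate⁻; ≡⇒Pointwise-≡)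
open import Data.Vec.Relation.Unary.Unique.Propositional.Properties using (tabulate⁺)
open import Function using (_∘_; _⇔_; mk⇔; Injective)
open import Function.Bundles using (module Injection; module Inverse; module Equivalence)
open import Function.Properties.Inverse using (Inverse⇒Injection)
open import Induction.WellFounded using (Acc; acc)
open import Relation.Binary.PropositionalEquality
  using (_≡_; _≗_; refl; sym; trans; cong; cong₂; subst; subst₂; module ≡-Reasoning)
open import Relation.Nullary using (does)
open import Relation.Nullary.Decidable using (does-⇔)

-- Reductions without communication, for all kinds of protocols.

record Reduction (P Q : Problem) : Set where
  private
    module P = Problem P
    module Q = Problem Q
  field
    alice     : P.Alice → Q.Alice
    bob       : P.Bob → Q.Bob
    correct-⇔ : ∀ x y → P.Yes x y ⇔ Q.Yes (alice x) (bob y)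

  answer-≡ : ∀ x y → Q.answer (alice x) (bob y) ≡ P.answer x y
  answer-≡ x y = sym (does-⇔ (correct-⇔ x y) (P.yes? x y) (Q.yes? (alice x) (bob y)))

module _ {X Y X′ Y′ : Set} (f : X → X′) (g : Y → Y′) where

  mapInputs : Protocol X′ Y′ → Protocol X Y
  mapInputs (output a)         = output a
  mapInputs (aliceSays s next) = aliceSays (s ∘ f) (mapInputs ∘ next)
  mapInputs (bobSays s next)   = bobSays (s ∘ g) (mapInputs ∘ next)

  result-mapInputs : ∀ π x y → result (mapInputs π) x y ≡ result π (f x) (g y)
  result-mapInputs (output a)         x y = refl
  result-mapInputs (aliceSays s next) x y = result-mapInputs (next (s (f x))) x y
  result-mapInputs (bobSays s next)   x y = result-mapInputs (next (s (g y))) x y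

  -- The protocol tree keeps its shape and both runs follow the same branch, so the translation of
  -- the inputs costs no bits.
  bitsExchanged-mapInputs : ∀ π x y →
    bitsExchanged (mapInputs π) x y ≡ bitsExchanged π (f x) (g y)
  bitsExchanged-mapInputs (output a)         x y = refl
  bitsExchanged-mapInputs (aliceSays s next) x y =
    cong suc (bitsExchanged-mapInputs (next (s (f x))) x y)
  bitsExchanged-mapInputs (bobSays s next)   x y =
    cong suc (bitsExchanged-mapInputs (next (s (g y))) x y)

Pr-cong : ∀ m .{{_ : NonZero m}} {E F : Fin m → Bool} → E ≗ F → Pr m E ≡ Pr m F
Pr-cong m E≗F = cong (λ v → ℤ.+ ∣ v ∣ ℚ./ m) (tabulate-cong E≗F)

module _ {P Q : Problem} (r : Reduction P Q) {b : ℕ} where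
  open Reduction r

  -- For fixed random strings the new protocol is correct exactly when the given one is correct on
  -- the translated inputs. The two success events coincide, so the bound 2/3 carries over.
  correct-≡ : ∀ {a a′} x y → a ≡ a′ →
    correct Q b a′ (alice x) (bob y) ≡ correct P b a x y
  correct-≡ {a} x y refl = cong (λ c → does (a Bool.≟ c)) (answer-≡ x y)

  reduce : ∀ kind → HasProtocol kind Q b → HasProtocol kind P b
  reduce deterministic (π , bits , ok) =
      mapInputs alice bob π
    , (λ x y → subst (_≤ b) (sym (bitsExchanged-mapInputs alice bob π x y))
                 (bits (alice x) (bob y)))
    , (λ x y → trans (result-mapInputs alice bob π x y)
                 (trans (ok (alice x) (bob y)) (answer-≡ x y)))
  reduce publicCoin (m , m≢0 , π , bits , ok) =
      m , m≢0 , mapInputs alice bob ∘ π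
    , (λ ω x y → subst (_≤ b) (sym (bitsExchanged-mapInputs alice bob (π ω) x y))
                   (bits ω (alice x) (bob y)))
    , (λ x y → subst ((ℤ.+ 2 ℚ./ 3) ℚ.≤_)
                 (Pr-cong m {{m≢0}} λ ω →
                   correct-≡ x y (result-mapInputs alice bob (π ω) x y))
                 (ok (alice x) (bob y)))
  reduce privateCoin (m , k , m≢0 , k≢0 , π , bits , ok) =
      -- Only the problem inputs are translated; `map₂` leaves each player's random string as it is.
      m , k , m≢0 , k≢0 , mapInputs (map₂ alice) (map₂ bob) π
    , (λ α β x y →
         subst (_≤ b)
           (sym (bitsExchanged-mapInputs (map₂ alice) (map₂ bob) π (α , x) (β , y)))
           (bits α β (alice x) (bob y)))
    , (λ x y → subst ((ℤ.+ 2 ℚ./ 3) ℚ.≤_)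
                 (Pr-cong (m * k) {{m*n≢0 m k {{m≢0}} {{k≢0}}}} λ i →
                   let (α , β) = remQuot {m} k i in
                   correct-≡ x y
                     (result-mapInputs (map₂ alice) (map₂ bob) π (α , x) (β , y)))
                 (ok (alice x) (bob y)))

-- Logarithms and binary codes.

n≤2*⌈n/2⌉ : ∀ n → n ≤ 2 * ⌈ n /2⌉
n≤2*⌈n/2⌉ n = begin
  n                    ≡⟨ ⌊n/2⌋+⌈n/2⌉≡n n ⟨
  ⌊ n /2⌋ + ⌈ n /2⌉    ≤⟨ +-monoˡ-≤ ⌈ n /2⌉ (⌊n/2⌋≤⌈n/2⌉ n) ⟩
  ⌈ n /2⌉ + ⌈ n /2⌉    ≡⟨ cong (⌈ n /2⌉ +_) (+-identityʳ ⌈ n /2⌉) ⟨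
  2 * ⌈ n /2⌉          ∎
  where open ≤-Reasoning

-- Induction along the recursion of `⌈log2⌉`, which passes from `2 + n` to its half rounded up,
-- `suc ⌈ n /2⌉`. The accessibility proof is arbitrary because each recursive call comes with its
-- own.
n≤2^⌈log2⌉n : ∀ n (rec : Acc _<_ n) → n ≤ 2 ^ ⌈log2⌉ n rec
n≤2^⌈log2⌉n 0             _        = z≤n
n≤2^⌈log2⌉n 1             _        = s≤s z≤n
n≤2^⌈log2⌉n (suc (suc n)) (acc rs) = begin
  2 + n                 ≤⟨ +-monoʳ-≤ 2 (n≤2*⌈n/2⌉ n) ⟩
  2 + 2 * ⌈ n /2⌉       ≡⟨ *-suc 2 ⌈ n /2⌉ ⟨
  2 * suc ⌈ n /2⌉       ≤⟨ *-monoʳ-≤ 2 (n≤2^⌈log2⌉n (suc ⌈ n /2⌉) _) ⟩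
  2 * 2 ^ ⌈log2⌉ (suc ⌈ n /2⌉) _ ∎
  where open ≤-Reasoning

n≤2^⌈log₂n⌉ : ∀ n → n ≤ 2 ^ ⌈log₂ n ⌉
n≤2^⌈log₂n⌉ n = n≤2^⌈log2⌉n n (<-wellFounded n)

funToFin-cong : ∀ {m n} {f g : Fin m → Fin n} → f ≗ g → funToFin f ≡ funToFin g
funToFin-cong {zero}  f≗g = refl
funToFin-cong {suc m} f≗g = cong₂ combine (f≗g zero) (funToFin-cong (f≗g ∘ suc))

-- `funToFin` is a left inverse that respects pointwise equality, so no function extensionality is
-- used.
finToFun-injective : ∀ {m n} (i j : Fin (n ^ m)) → finToFun {n} {m} i ≗ finToFun {n} {m} j → i ≡ j
finToFun-injective {m} {n} i j eq = begin
  i                                ≡⟨ funToFin-finToFin {m} {n} i ⟨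
  funToFin (finToFun {n} {m} i)    ≡⟨ funToFin-cong {m} eq ⟩
  funToFin (finToFun {n} {m} j)    ≡⟨ funToFin-finToFin {m} {n} j ⟩
  j                                ∎
  where open ≡-Reasoning

-- The base-2 digits of the index, once it is embedded into `Fin (2 ^ ⌈log₂ n ⌉)`.
code : ∀ n → Fin n → BitVector ⌈log₂ n ⌉
code n i = tabulate (Inverse.to 2↔Bool ∘ finToFun (inject≤ i (n≤2^⌈log₂n⌉ n)))

code-injective : ∀ n → Injective _≡_ _≡_ (code n)
code-injective n {i} {j} eq =
  inject≤-injective (n≤2^⌈log₂n⌉ n) (n≤2^⌈log₂n⌉ n) i j
    (finToFun-injective {m = ⌈log₂ n ⌉} _ _
      (Injection.injective (Inverse⇒Injection 2↔Bool) ∘ tabulate⁻ (≡⇒Pointwise-≡ eq)))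

-- Orthogonality, coordinate by coordinate.

Annihilate : Bool → Bool → Set
Annihilate a b = a ≡ false ⊎ b ≡ false

-- The inductive form can be split along `_++_` and `_∷_`, block by block.
orthogonal⇔pointwise : ∀ {d} {l r : BitVector d} →
  Orthogonal l r ⇔ Pointwise Annihilate l r
orthogonal⇔pointwise =
  mk⇔ (extensional⇒inductive ∘ ext) (Extensional.Pointwise.app ∘ inductive⇒extensional)

annihilate-not : ∀ a → Annihilate a (not a)
annihilate-not true  = inj₂ refl
annihilate-not false = inj₁ refl

not-annihilate : ∀ a → Annihilate (not a) a
not-annihilate true  = inj₁ refl
not-annihilate false = inj₂ refl

-- The first condition excludes the pair (1, 0), the second the pair (0, 1). This is why the vectors
-- contain each code together with its complement.
annihilate-not⁻ : ∀ a b → Annihilate a (not b) → Annihilate (not a) b → a ≡ b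
annihilate-not⁻ true  true  _         _         = refl
annihilate-not⁻ false false _         _         = refl
annihilate-not⁻ true  false (inj₁ ()) _
annihilate-not⁻ true  false (inj₂ ()) _
annihilate-not⁻ false true  _         (inj₁ ())
annihilate-not⁻ false true  _         (inj₂ ())

pointwise-not : ∀ {n} (u : BitVector n) → Pointwise Annihilate u (map not u)
pointwise-not []      = []
pointwise-not (a ∷ u) = annihilate-not a ∷ pointwise-not u

not-pointwise : ∀ {n} (u : BitVector n) → Pointwise Annihilate (map not u) u
not-pointwise []      = []
not-pointwise (a ∷ u) = not-annihilate a ∷ not-pointwise u

pointwise-not⁻ : ∀ {n} (u v : BitVector n) →
  Pointwise Annihilate u (map not v) → Pointwise Annihilate (map not u) v → u ≡ v
pointwise-not⁻ []      []      []       []       = refl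
pointwise-not⁻ (a ∷ u) (b ∷ v) (p ∷ ps) (q ∷ qs) =
  cong₂ _∷_ (annihilate-not⁻ a b p q) (pointwise-not⁻ u v ps qs)

-- The empty vectors make the dimension 2 * ℓ + 3 hold by computation.

aliceVector bobVector : ∀ {ℓ} → BitVector ℓ → Bool → BitVector (2 * ℓ + 3)
aliceVector e a = (e ++ map not e ++ []) ++ (true ∷ not a ∷ false ∷ [])
bobVector   e b = (map not e ++ e ++ []) ++ (not b ∷ true ∷ false ∷ [])

aliceVector-injective : ∀ {ℓ} (e e′ : BitVector ℓ) {a a′} →
  aliceVector e a ≡ aliceVector e′ a′ → e ≡ e′
aliceVector-injective e e′ eq =
  ++-injectiveˡ e e′ (++-injectiveˡ (e ++ map not e ++ []) (e′ ++ map not e′ ++ []) eq)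

bobVector-injective : ∀ {ℓ} (e e′ : BitVector ℓ) {b b′} →
  bobVector e b ≡ bobVector e′ b′ → e ≡ e′
bobVector-injective e e′ eq =
  -- Comparing the second blocks yields the code itself rather than its complement.
  ++-injectiveˡ e e′ (++-injectiveʳ (map not e) (map not e′)
    (++-injectiveˡ (map not e ++ e ++ []) (map not e′ ++ e′ ++ []) eq))

vectors-orthogonal : ∀ {ℓ} (e : BitVector ℓ) →
  Pointwise Annihilate (aliceVector e true) (bobVector e true)
vectors-orthogonal e =
  ++⁺ (++⁺ (pointwise-not e) (++⁺ (not-pointwise e) []))
      -- The tails are (1, 0, 0) and (0, 1, 0).
      (inj₂ refl ∷ inj₁ refl ∷ inj₁ refl ∷ [])

vectors-orthogonal⁻ : ∀ {ℓ} (e f : BitVector ℓ) a b →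
  Pointwise Annihilate (aliceVector e a) (bobVector f b) → e ≡ f × a ≡ true × b ≡ true
vectors-orthogonal⁻ e f a b p
  with heads , tails ← ++⁻ (e ++ map not e ++ []) (map not f ++ f ++ []) p
  with ps , qs ← ++⁻ e (map not f) heads
  = pointwise-not⁻ e f ps (proj₁ (++⁻ (map not e) f qs)) , flags a b tails
  where
  -- The first coordinate pairs 1 with ¬b and so forces b = 1; the second pairs ¬a with 1 and so
  -- forces a = 1.
  flags : ∀ a b → Pointwise Annihilate (true ∷ not a ∷ false ∷ []) (not b ∷ true ∷ false ∷ []) →
          a ≡ true × b ≡ true
  flags true  true  _                 = refl , refl
  flags true  false (inj₁ () ∷ _)
  flags true  false (inj₂ () ∷ _)
  flags false _     (_ ∷ inj₁ () ∷ _)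
  flags false _     (_ ∷ inj₂ () ∷ _)

-- The reduction from set disjointness to orthogonal vectors.

disjointness⇒orthogonal : ∀ n →
  Reduction (setDisjointness n) (orthogonalVectors n (2 * ⌈log₂ n ⌉ + 3))
disjointness⇒orthogonal n = record
  { alice     = λ x → record
      { vectors  = tabulate (l x)
      ; distinct = tabulate⁺ λ {i} {j} →
          code-injective n ∘ aliceVector-injective (code n i) (code n j)
      }
  ; bob       = λ y → record
      { vectors  = tabulate (r y)
      ; distinct = tabulate⁺ λ {i} {j} →
          code-injective n ∘ bobVector-injective (code n i) (code n j)
      }
  ; correct-⇔ = λ x y → mk⇔ (to x y) (from x y)
  }
  where
  l r : BitVector n → Fin n → BitVector (2 * ⌈log₂ n ⌉ + 3)
  l x i = aliceVector (code n i) (lookup x i)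
  r y j = bobVector (code n j) (lookup y j)

  to : ∀ x y → Problem.Yes (setDisjointness n) x y → _
  to x y (k , xk , yk) =
    -- A common element k makes the two k-th vectors orthogonal: their codes agree and both bits are
    -- 1.
    k , k , subst₂ Orthogonal (sym (lookup∘tabulate (l x) k)) (sym (lookup∘tabulate (r y) k))
      (Equivalence.from orthogonal⇔pointwise
        (subst₂ (λ a b → Pointwise Annihilate (aliceVector (code n k) a) (bobVector (code n k) b))
          (sym xk) (sym yk) (vectors-orthogonal (code n k))))

  from : ∀ x y → _ → Problem.Yes (setDisjointness n) x y
  from x y (i , j , o)
    with vectors-orthogonal⁻ (code n i) (code n j) (lookup x i) (lookup y j)
           (Equivalence.to orthogonal⇔pointwise
             (subst₂ Orthogonal (lookup∘tabulate (l x) i) (lookup∘tabulate (r y) j) o))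
  -- Equal codes give i = j, so the two bits found to be 1 sit at a common index.
  ... | ei≡ej , xi , yj with refl ← code-injective n ei≡ej = i , xi , yj

theorem2p1 : ∀ (kind : Kind) (n b : ℕ) → n ≥ 1 →
    HasProtocol kind (orthogonalVectors n (2 * ⌈log₂ n ⌉ + 3)) b →
    HasProtocol kind (setDisjointness n) b
theorem2p1 kind n b _ = reduce (disjointness⇒orthogonal n) kind
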